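{- Let $D^-$ be the additive code defined in the context and let $D^{3- }$ be any code of length $9$ obtained from $D^-$ by puncturing (deleting) any two of its coordinates. Then the trace dual $(D^{3- })^\perp$ has weight distribution $[\langle 0,1\rangle,\langle 6,36\rangle,\langle 8,27\rangle]$, i.e. it contains $1$ word of weight $0$, $36$ of weight $6$, $27$ of weight $8$ and no others.
   Context: $\mathbb{F}_4=\{0,1,\omega,\omega^2\}$ with $\omega^2=\omega+1$; $\mathrm{Tr}(z)=z+z^2$. The dual of an additive code $C\subseteq\mathbb{F}_4^n$ is $C^\perp=\{y: \sum_i\mathrm{Tr}(x_iy_i^2)=0\ \forall x\in C\}$. Puncturing at a coordinate means projecting onto the remaining coordinates. $D^-$ is the $\mathbb{F}_2$-span of the following $12$ vectors of $\mathbb{F}_4^{11}$: $(0,0,0,0,0,\omega^2,\omega^2,0,\omega,1,\omega)$, $(0,0,0,0,0,\omega,0,\omega,\omega,\omega,1)$, $(1,0,0,0,0,1,0,1,\omega^2,\omega^2,1)$, $(\omega,0,0,0,0,0,\omega,1,\omega,\omega,\omega)$, $(0,1,0,0,0,0,1,1,1,\omega^2,\omega^2)$, $(0,\omega,0,0,0,\omega^2,1,\omega^2,\omega,\omega,0)$, $(0,0,1,0,0,\omega,\omega,1,1,0,1)$, $(0,0,\omega,0,0,\omega,1,\omega,\omega^2,\omega^2,0)$, $(0,0,0,1,0,\omega,\omega,\omega,0,1,\omega)$, $(0,0,0,\omega,0,\omega^2,1,1,\omega^2,0,\omega)$, $(0,0,0,0,1,\omega^2,\omega^2,\omega^2,1,0,\omega^2)$,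 $(0,0,0,0,\omega,\omega,1,0,1,\omega,\omega)$. -}

module Defs where

open import Data.Nat using (ℕ; zero; suc)
open import Data.Nat.Properties using (_≟_)
open import Data.Bool using (Bool; true; false)
open import Data.Fin using (Fin)
open import Data.Vec using (Vec; []; _∷_; zipWith; foldr; removeAt; replicate)
open import Data.List using (List; length; filter)
open import Data.List.Membership.Propositional using (_∈_)
open import Data.List.Relation.Unary.Unique.Propositional using (Unique)
open import Data.Product using (Σ; _×_; _,_)
open import Relation.Binary.PropositionalEquality using (_≡_)
open import Function.Bundles using (_⇔_)

data F4 : Set where
  𝟎 𝟏 ω ω² : F4

infixl 6 _+F_
infixl 7 _*F_

_+F_ : F4 → F4 → F4
𝟎  +F y  = y
x  +F 𝟎  = x
𝟏  +F 𝟏  = 𝟎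
𝟏  +F ω  = ω²
𝟏  +F ω² = ω
ω  +F 𝟏  = ω²
ω  +F ω  = 𝟎
ω  +F ω² = 𝟏
ω² +F 𝟏  = ω
ω² +F ω  = 𝟏
ω² +F ω² = 𝟎

_*F_ : F4 → F4 → F4
𝟎  *F y  = 𝟎
x  *F 𝟎  = 𝟎
𝟏  *F y  = y
x  *F 𝟏  = x
ω  *F ω  = ω²
ω  *F ω² = 𝟏
ω² *F ω  = 𝟏
ω² *F ω² = ω

Tr : F4 → F4
Tr z = z +F (z *F z)

Word : ℕ → Set
Word n = Vec F4 n

Code : ℕ → Set₁
Code n = Word n → Set

traceIP : ∀ {n} → Word n → Word n → F4
traceIP x y = foldr _ _+F_ 𝟎 (zipWith (λ a b → Tr (a *F (b *F b))) x y)

dual : ∀ {n} → Code n → Code n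
dual C y = ∀ x → C x → traceIP x y ≡ 𝟎

_⊕_ : ∀ {n} → Word n → Word n → Word n
_⊕_ = zipWith _+F_

lincomb : ∀ {n m} → Vec Bool m → Vec (Word n) m → Word n
lincomb [] [] = replicate _ 𝟎
lincomb (false ∷ cs) (g ∷ gs) = lincomb cs gs
lincomb (true  ∷ cs) (g ∷ gs) = g ⊕ lincomb cs gs

span : ∀ {n m} → Vec (Word n) m → Code n
span gs v = Σ (Vec Bool _) λ c → lincomb c gs ≡ v

gensD : Vec (Word 11) 12
gensD =
    (𝟎 ∷ 𝟎 ∷ 𝟎 ∷ 𝟎 ∷ 𝟎 ∷ ω² ∷ ω² ∷ 𝟎 ∷ ω ∷ 𝟏 ∷ ω ∷ [])
  ∷ (𝟎 ∷ 𝟎 ∷ 𝟎 ∷ 𝟎 ∷ 𝟎 ∷ ω ∷ 𝟎 ∷ ω ∷ ω ∷ ω ∷ 𝟏 ∷ [])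
  ∷ (𝟏 ∷ 𝟎 ∷ 𝟎 ∷ 𝟎 ∷ 𝟎 ∷ 𝟏 ∷ 𝟎 ∷ 𝟏 ∷ ω² ∷ ω² ∷ 𝟏 ∷ [])
  ∷ (ω ∷ 𝟎 ∷ 𝟎 ∷ 𝟎 ∷ 𝟎 ∷ 𝟎 ∷ ω ∷ 𝟏 ∷ ω ∷ ω ∷ ω ∷ [])
  ∷ (𝟎 ∷ 𝟏 ∷ 𝟎 ∷ 𝟎 ∷ 𝟎 ∷ 𝟎 ∷ 𝟏 ∷ 𝟏 ∷ 𝟏 ∷ ω² ∷ ω² ∷ [])
  ∷ (𝟎 ∷ ω ∷ 𝟎 ∷ 𝟎 ∷ 𝟎 ∷ ω² ∷ 𝟏 ∷ ω² ∷ ω ∷ ω ∷ 𝟎 ∷ [])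
  ∷ (𝟎 ∷ 𝟎 ∷ 𝟏 ∷ 𝟎 ∷ 𝟎 ∷ ω ∷ ω ∷ 𝟏 ∷ 𝟏 ∷ 𝟎 ∷ 𝟏 ∷ [])
  ∷ (𝟎 ∷ 𝟎 ∷ ω ∷ 𝟎 ∷ 𝟎 ∷ ω ∷ 𝟏 ∷ ω ∷ ω² ∷ ω² ∷ 𝟎 ∷ [])
  ∷ (𝟎 ∷ 𝟎 ∷ 𝟎 ∷ 𝟏 ∷ 𝟎 ∷ ω ∷ ω ∷ ω ∷ 𝟎 ∷ 𝟏 ∷ ω ∷ [])
  ∷ (𝟎 ∷ 𝟎 ∷ 𝟎 ∷ ω ∷ 𝟎 ∷ ω² ∷ 𝟏 ∷ 𝟏 ∷ ω² ∷ 𝟎 ∷ ω ∷ [])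
  ∷ (𝟎 ∷ 𝟎 ∷ 𝟎 ∷ 𝟎 ∷ 𝟏 ∷ ω² ∷ ω² ∷ ω² ∷ 𝟏 ∷ 𝟎 ∷ ω² ∷ [])
  ∷ (𝟎 ∷ 𝟎 ∷ 𝟎 ∷ 𝟎 ∷ ω ∷ ω ∷ 𝟏 ∷ 𝟎 ∷ 𝟏 ∷ ω ∷ ω ∷ [])
  ∷ []

D⁻ : Code 11
D⁻ = span gensD

puncture : ∀ {n} → Fin (suc n) → Code (suc n) → Code n
puncture i C y = Σ (Word _) λ x → C x × removeAt x i ≡ y

-- Puncturing D⁻ at two distinct coordinates: delete coordinate i of F4^11,
-- then coordinate j of the resulting F4^10.  Every pair of distinct
-- coordinates arises this way (and every (i , j) gives such a pair).
D3⁻ : Fin 11 → Fin 10 → Code 9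
D3⁻ i j = puncture j (puncture i D⁻)

wt : ∀ {n} → Word n → ℕ
wt [] = 0
wt (𝟎 ∷ xs) = wt xs
wt (_ ∷ xs) = suc (wt xs)

countWt : ∀ {n} → ℕ → List (Word n) → ℕ
countWt w L = length (filter (λ y → wt y ≟ w) L)

HasWeightDistribution : ∀ {n} → Code n → (ℕ → ℕ) → Set
HasWeightDistribution {n} C A =
  Σ (List (Word n)) λ L →
    Unique L × (∀ y → (y ∈ L) ⇔ C y) × (∀ w → countWt w L ≡ A w)

dist-5 : ℕ → ℕ
dist-5 0 = 1
dist-5 6 = 36
dist-5 8 = 27
dist-5 _ = 0

{-# OPTIONS --safe #-}
-- The dual of a punctured code is the shortened dual code, so a list of the
-- 2¹⁰ words of (D⁻)^⊥ yields, by shortening twice, the words of every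
-- (D³⁻)^⊥.  The words orthogonal to the generators are found coordinate by
-- coordinate from the right: a generator with zero first entry already
-- constrains the tail of a word.  Thanks to the systematic form of the
-- generators at most 4⁶ candidates occur at any stage, so the weights can
-- be counted by evaluation.
module Submission where

open import Defs
open import Data.Bool using (true; false)
open import Data.Fin using (Fin; zero; suc; toℕ; fromℕ<)
open import Data.Fin.Properties using (all?; toℕ-fromℕ<)
open import Data.List using (List; []; _∷_; length; filter; map; cartesianProductWith)
open import Data.List.Membership.Propositional using (_∈_)
open import Data.List.Membership.Propositional.Properties using (∈-map⁺; ∈-map⁻; ∈-filter⁺; ∈-filter⁻; ∈-cartesianProductWith⁺)
open import Data.List.Properties using (filter-none; map-∘; map-id-local)
open import Data.List.Relation.Unary.All as All using (All; []; _∷_)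
open import Data.List.Relation.Unary.All.Properties using (all-filter)
open import Data.List.Relation.Unary.AllPairs using ([]; _∷_)
open import Data.List.Relation.Unary.Any using (here; there)
open import Data.List.Relation.Unary.Unique.Propositional using (Unique)
open import Data.List.Relation.Unary.Unique.Propositional.Properties using (map⁻; filter⁺; cartesianProductWith⁺)
open import Data.Nat using (ℕ; zero; suc; _≤_; _<_; z≤n; s≤s)
open import Data.Nat.Properties using (_≟_; _<?_; ≮⇒≥; m≤n⇒m≤1+n; ≤-<-trans; <⇒≢)
open import Data.Product using (_,_; proj₂)
open import Data.Vec using (Vec; []; _∷_; head; tail; lookup; insertAt; removeAt; replicate; toList)
open import Data.Vec.Properties using (insertAt-lookup; insertAt-removeAt; removeAt-insertAt; zipWith-identityʳ; ∷-injective)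
open import Function using (_∘_)
open import Function.Bundles using (mk⇔)
open import Level using (Level)
open import Relation.Binary.Definitions using (DecidableEquality)
open import Relation.Binary.PropositionalEquality using (_≡_; refl; sym; trans; cong; cong₂; subst)
open import Relation.Nullary using (Dec; does; yes; no)
open import Relation.Nullary.Decidable using (map′; toWitness)
open import Relation.Unary using (Pred; Decidable)

private
  variable
    p : Level
    m n : ℕ

infix 4 _≟F_

-- Finite arithmetic in `F4` and the trace form.

_≟F_ : DecidableEquality F4
𝟎  ≟F 𝟎  = yes refl
𝟎  ≟F 𝟏  = no λ ()
𝟎  ≟F ω  = no λ ()
𝟎  ≟F ω² = no λ ()
𝟏  ≟F 𝟎  = no λ ()
𝟏  ≟F 𝟏  = yes refl
𝟏  ≟F ω  = no λ ()
𝟏  ≟F ω² = no λ ()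
ω  ≟F 𝟎  = no λ ()
ω  ≟F 𝟏  = no λ ()
ω  ≟F ω  = yes refl
ω  ≟F ω² = no λ ()
ω² ≟F 𝟎  = no λ ()
ω² ≟F 𝟏  = no λ ()
ω² ≟F ω  = no λ ()
ω² ≟F ω² = yes refl

elements : List F4
elements = 𝟎 ∷ 𝟏 ∷ ω ∷ ω² ∷ []

∈-elements : ∀ a → a ∈ elements
∈-elements 𝟎  = here refl
∈-elements 𝟏  = there (here refl)
∈-elements ω  = there (there (here refl))
∈-elements ω² = there (there (there (here refl)))

elements-unique : Unique elements
elements-unique =
    ((λ ()) ∷ (λ ()) ∷ (λ ()) ∷ [])
  ∷ ((λ ()) ∷ (λ ()) ∷ [])
  ∷ ((λ ()) ∷ [])
  ∷ []
  ∷ []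

-- Nested uses decide identities in several variables, so the laws below are settled by evaluation
-- on all values.
∀F? : {P : Pred F4 p} → Decidable P → Dec (∀ a → P a)
∀F? P? = map′ (λ ps a → All.lookup ps (∈-elements a)) (λ f → All.tabulate λ {a} _ → f a)
              (All.all? P? elements)

+F-identityʳ : ∀ a → a +F 𝟎 ≡ a
+F-identityʳ = toWitness {a? = ∀F? λ a → a +F 𝟎 ≟F a} _

+F-interchange : ∀ a b c d → (a +F b) +F (c +F d) ≡ (a +F c) +F (b +F d)
+F-interchange = toWitness {a? = ∀F? λ a → ∀F? λ b → ∀F? λ c → ∀F? λ d →
  (a +F b) +F (c +F d) ≟F (a +F c) +F (b +F d)} _

⟨_,_⟩ : F4 → F4 → F4
⟨ a , b ⟩ = Tr (a *F (b *F b))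

⟨⟩-additiveˡ : ∀ a b c → ⟨ a +F b , c ⟩ ≡ ⟨ a , c ⟩ +F ⟨ b , c ⟩
⟨⟩-additiveˡ = toWitness {a? = ∀F? λ a → ∀F? λ b → ∀F? λ c →
  ⟨ a +F b , c ⟩ ≟F ⟨ a , c ⟩ +F ⟨ b , c ⟩} _

⟨⟩-zeroʳ : ∀ a → ⟨ a , 𝟎 ⟩ ≡ 𝟎
⟨⟩-zeroʳ = toWitness {a? = ∀F? λ a → ⟨ a , 𝟎 ⟩ ≟F 𝟎} _

traceIP-additiveˡ : ∀ (x x′ y : Word n) → traceIP (x ⊕ x′) y ≡ traceIP x y +F traceIP x′ y
traceIP-additiveˡ []       []         []      = refl
traceIP-additiveˡ (a ∷ x) (a′ ∷ x′) (b ∷ y) =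
  trans (cong₂ _+F_ (⟨⟩-additiveˡ a a′ b) (traceIP-additiveˡ x x′ y))
        (+F-interchange ⟨ a , b ⟩ ⟨ a′ , b ⟩ (traceIP x y) (traceIP x′ y))

traceIP-zeroˡ : ∀ (y : Word n) → traceIP (replicate n 𝟎) y ≡ 𝟎
traceIP-zeroˡ []      = refl
traceIP-zeroˡ (b ∷ y) = traceIP-zeroˡ y

-- The dual of a span as a finite set of conditions.

Orthogonal : List (Word n) → Code n
Orthogonal gs y = All (λ g → traceIP g y ≡ 𝟎) gs

orthogonal? : (gs : List (Word n)) → Decidable (Orthogonal gs)
orthogonal? gs y = All.all? (λ g → traceIP g y ≟F 𝟎) gs

lincomb-zero : (gs : Vec (Word n) m) → lincomb (replicate m false) gs ≡ replicate n 𝟎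
lincomb-zero []       = refl
lincomb-zero (g ∷ gs) = lincomb-zero gs

dual-span⇒orthogonal : (gs : Vec (Word n) m) → ∀ {y} → dual (span gs) y → Orthogonal (toList gs) y
dual-span⇒orthogonal []       _ = []
dual-span⇒orthogonal (g ∷ gs) d =
    -- The first generator is the combination with coefficient `true` on itself and `false` on all
    -- others.
    d g (true ∷ replicate _ false , trans (cong (g ⊕_) (lincomb-zero gs)) (zipWith-identityʳ +F-identityʳ g))
  ∷ dual-span⇒orthogonal gs λ x (c , eq) → d x (false ∷ c , eq)

orthogonal⇒dual-span : (gs : Vec (Word n) m) → ∀ {y} → Orthogonal (toList gs) y → dual (span gs) y
orthogonal⇒dual-span gs₀ {y} o x (c₀ , refl) = go c₀ gs₀ o
  where
  -- Generalised over coefficients and generators, so that the induction can peel off generators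
  -- while `y` stays fixed.
  go : ∀ {m} c (gs : Vec (Word _) m) → Orthogonal (toList gs) y → traceIP (lincomb c gs) y ≡ 𝟎
  go []          []       []       = traceIP-zeroˡ y
  go (false ∷ c) (g ∷ gs) (_ ∷ os) = go c gs os
  go (true ∷ c)  (g ∷ gs) (o ∷ os) =
    trans (traceIP-additiveˡ g (lincomb c gs) y) (cong₂ _+F_ o (go c gs os))

-- Listing the words orthogonal to given generators.

record Enumerates (L : List (Word n)) (C : Code n) : Set where
  field
    unique : Unique L
    sound  : ∀ {y} → y ∈ L → C y
    full   : ∀ {y} → C y → y ∈ L

open Enumerates

startsWith𝟎? : Decidable (λ (g : Word (suc n)) → head g ≡ 𝟎)
startsWith𝟎? g = head g ≟F 𝟎

tailConstraints : List (Word (suc n)) → List (Word n)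
tailConstraints gs = map tail (filter startsWith𝟎? gs)

-- Filtering by all of `gs` at each stage makes soundness immediate. The tail constraints only limit
-- the candidates, so completeness is where they must be shown necessary. At length 0 every inner
-- product is an empty sum.
solutions : List (Word n) → List (Word n)
solutions {zero}  gs = [] ∷ []
solutions {suc n} gs =
  filter (orthogonal? gs) (cartesianProductWith _∷_ elements (solutions (tailConstraints gs)))

-- A first entry `𝟎` contributes `𝟎` to the inner product whatever `b` is, so the condition on the
-- whole word computes to the one on its tail.
tailConstraints-orthogonal : ∀ (gs : List (Word (suc n))) {b y} →
  Orthogonal gs (b ∷ y) → Orthogonal (tailConstraints gs) y
tailConstraints-orthogonal []              []       = []
tailConstraints-orthogonal ((𝟎  ∷ g) ∷ gs) (o ∷ os) = o ∷ tailConstraints-orthogonal gs os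
tailConstraints-orthogonal ((𝟏  ∷ g) ∷ gs) (o ∷ os) = tailConstraints-orthogonal gs os
tailConstraints-orthogonal ((ω  ∷ g) ∷ gs) (o ∷ os) = tailConstraints-orthogonal gs os
tailConstraints-orthogonal ((ω² ∷ g) ∷ gs) (o ∷ os) = tailConstraints-orthogonal gs os

orthogonal-[] : (gs : List (Word 0)) → Orthogonal gs []
orthogonal-[] []        = []
orthogonal-[] ([] ∷ gs) = refl ∷ orthogonal-[] gs

solutions-enumerates : (gs : List (Word n)) → Enumerates (solutions gs) (Orthogonal gs)
solutions-enumerates {zero} gs = record
  { unique = [] ∷ []
  ; sound  = λ { {[]} _ → orthogonal-[] gs }
  ; full   = λ { {[]} _ → here refl }
  }
solutions-enumerates {suc n} gs = record
  { unique = filter⁺ (orthogonal? gs)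
               (cartesianProductWith⁺ _∷_ ∷-injective elements-unique (unique rec))
  ; sound  = λ y∈ → proj₂ (∈-filter⁻ (orthogonal? gs) {xs = candidates} y∈)
  ; full   = λ { {b ∷ y} o → ∈-filter⁺ (orthogonal? gs)
               (∈-cartesianProductWith⁺ _∷_ (∈-elements b) (full rec (tailConstraints-orthogonal gs o))) o }
  }
  where
  rec        = solutions-enumerates (tailConstraints gs)
  candidates = cartesianProductWith _∷_ elements (solutions (tailConstraints gs))

dual-span-enumerates : (gs : Vec (Word n) m) → Enumerates (solutions (toList gs)) (dual (span gs))
dual-span-enumerates gs = record
  { unique = unique E
  ; sound  = orthogonal⇒dual-span gs ∘ sound E
  ; full   = full E ∘ dual-span⇒orthogonal gs
  }
  where E = solutions-enumerates (toList gs)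

-- Shortening as the dual of puncturing.

traceIP-insertAt-𝟎 : ∀ (x : Word (suc n)) i y → traceIP x (insertAt y i 𝟎) ≡ traceIP (removeAt x i) y
traceIP-insertAt-𝟎 (a ∷ x)          zero    y       = cong (_+F traceIP x y) (⟨⟩-zeroʳ a)
traceIP-insertAt-𝟎 (a ∷ x@(_ ∷ _)) (suc i) (b ∷ y) = cong (⟨ a , b ⟩ +F_) (traceIP-insertAt-𝟎 x i y)

vanishesAt? : (i : Fin n) → Decidable (λ (x : Word n) → lookup x i ≡ 𝟎)
vanishesAt? i x = lookup x i ≟F 𝟎

shorten : Fin (suc n) → List (Word (suc n)) → List (Word n)
shorten i L = map (λ x → removeAt x i) (filter (vanishesAt? i) L)

insertAt-𝟎-removeAt : ∀ (x : Word (suc n)) i → lookup x i ≡ 𝟎 → insertAt (removeAt x i) i 𝟎 ≡ x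
insertAt-𝟎-removeAt x i eq = subst (λ a → insertAt (removeAt x i) i a ≡ x) eq (insertAt-removeAt x i)

-- Deletion at `i` is injective on words vanishing there: inserting `𝟎` recovers them, and
-- uniqueness is pulled back along this insertion.
shorten-unique : ∀ i {L : List (Word (suc n))} → Unique L → Unique (shorten i L)
shorten-unique i {L} L! = map⁻ {f = λ y → insertAt y i 𝟎} (subst Unique (sym reinsert) (filter⁺ (vanishesAt? i) L!))
  where
  reinsert : map (λ y → insertAt y i 𝟎) (shorten i L) ≡ filter (vanishesAt? i) L
  reinsert = trans (sym (map-∘ _))
    (map-id-local (All.map (λ {x} → insertAt-𝟎-removeAt x i) (all-filter (vanishesAt? i) L)))

-- An inserted `𝟎` ignores the deleted entry of a codeword, so `y` is orthogonal to the punctured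
-- code exactly when its extension by `𝟎` at `i` is orthogonal to `C`.
shorten-enumerates : ∀ i {L : List (Word (suc n))} {C} →
  Enumerates L (dual C) → Enumerates (shorten i L) (dual (puncture i C))
shorten-enumerates i {L} {C} E = record
  { unique = shorten-unique i (unique E)
  ; sound  = shortened-sound
  ; full   = shortened-full
  }
  where
  shortened-sound : ∀ {y} → y ∈ shorten i L → dual (puncture i C) y
  shortened-sound y∈ _ (x , Cx , refl)
    with z , z∈ , refl ← ∈-map⁻ _ y∈
    with z∈L , zi≡𝟎 ← ∈-filter⁻ (vanishesAt? i) {xs = L} z∈ =
    trans (sym (traceIP-insertAt-𝟎 x i (removeAt z i)))
      (trans (cong (traceIP x) (insertAt-𝟎-removeAt z i zi≡𝟎)) (sound E z∈L x Cx))

  shortened-full : ∀ {y} → dual (puncture i C) y → y ∈ shorten i L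
  -- `y` is presented as the deletion at `i` of `insertAt y i 𝟎`, the word shown to lie in `L`.
  shortened-full {y} d = subst (_∈ shorten i L) (removeAt-insertAt y i 𝟎)
    (∈-map⁺ _ (∈-filter⁺ (vanishesAt? i)
      (full E λ x Cx → trans (traceIP-insertAt-𝟎 x i y) (d _ (x , Cx , refl)))
      (insertAt-lookup y i 𝟎)))

-- Counting words by weight.

wt≤length : (y : Word n) → wt y ≤ n
wt≤length []       = z≤n
wt≤length (𝟎  ∷ y) = m≤n⇒m≤1+n (wt≤length y)
wt≤length (𝟏  ∷ y) = s≤s (wt≤length y)
wt≤length (ω  ∷ y) = s≤s (wt≤length y)
wt≤length (ω² ∷ y) = s≤s (wt≤length y)

countWt-large : ∀ {w} (L : List (Word n)) → n < w → countWt w L ≡ 0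
countWt-large {w = w} L n<w = cong length (filter-none (λ y → wt y ≟ w)
  (All.universal (λ y → <⇒≢ (≤-<-trans (wt≤length y) n<w)) L))

witness : {P : Set p} (P? : Dec P) → does P? ≡ true → P
witness (yes holds) _ = holds

-- Words of length 9 have weight at most 9, so restricting to these ten weights leaves a decidable
-- check.
SmallWeights : List (Word 9) → Set
SmallWeights L = ∀ (w : Fin 10) → countWt (toℕ w) L ≡ dist-5 (toℕ w)

dist-5-large : ∀ {w} → 9 < w → dist-5 w ≡ 0
-- Nine exposed successors take `w` past 8, the largest weight listed in `dist-5`, so its last
-- clause computes.
dist-5-large (s≤s (s≤s (s≤s (s≤s (s≤s (s≤s (s≤s (s≤s (s≤s _))))))))) = refl

smallWeights⇒allWeights : ∀ L → SmallWeights L → ∀ w → countWt w L ≡ dist-5 w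
smallWeights⇒allWeights L small w with w <? 10
... | yes w<10 = subst (λ v → countWt v L ≡ dist-5 v) (toℕ-fromℕ< w<10) (small (fromℕ< w<10))
-- `10 ≤ w` unfolds to `9 < w`, where the count and `dist-5 w` are both 0.
... | no  w≮10 = trans (countWt-large L (≮⇒≥ w≮10)) (sym (dist-5-large (≮⇒≥ w≮10)))

smallWeights? : Decidable SmallWeights
smallWeights? L = all? λ w → countWt (toℕ w) L ≟ dist-5 (toℕ w)

-- The successive shortenings are passed as arguments so that evaluation shares them.
shortenings₁? : (L : List (Word 10)) → Dec (∀ j → SmallWeights (shorten j L))
shortenings₁? L = all? λ j → smallWeights? (shorten j L)

shortenings₂? : (L : List (Word 11)) → Dec (∀ i j → SmallWeights (shorten j (shorten i L)))
shortenings₂? L = all? λ i → shortenings₁? (shorten i L)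

D⁻-dual : List (Word 11)
D⁻-dual = solutions (toList gensD)

D3⁻-dual : Fin 11 → Fin 10 → List (Word 9)
D3⁻-dual i j = shorten j (shorten i D⁻-dual)

-- Unlike `True`, an equation makes the type checker run the decision procedure only once.
shortenings₂-hold : does (shortenings₂? D⁻-dual) ≡ true
shortenings₂-hold = refl

D3⁻-dual-smallWeights : ∀ i j → SmallWeights (D3⁻-dual i j)
D3⁻-dual-smallWeights = witness (shortenings₂? D⁻-dual) shortenings₂-hold

theorem5 : (i : Fin 11) (j : Fin 10) → HasWeightDistribution (dual (D3⁻ i j)) dist-5
theorem5 i j =
    D3⁻-dual i j
  , unique E
  , (λ y → mk⇔ (sound E) (full E))
  , smallWeights⇒allWeights (D3⁻-dual i j) (D3⁻-dual-smallWeights i j)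
  where
  E : Enumerates (D3⁻-dual i j) (dual (D3⁻ i j))
  -- The shortenings follow the order of the puncturings: `i` first, then `j` among the ten
  -- remaining coordinates.
  E = shorten-enumerates j (shorten-enumerates i (dual-span-enumerates gensD))
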